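{- Let $G$ be a non-regular bipartite graph of order $m$ with a bipartition such that, within each of the two partite sets, all vertices have the same degree. Let $H$ be a $2t$-regular graph of order $n$ that admits a neighborhood balanced coloring and that admits a local distance antimagic labeling. Then $\chi_{ld}(G[H])\leq 2\,\chi_{ld}(H)$.
   Context: All graphs are finite, simple, undirected and without isolated vertices. For a graph $G$ of order $n$ and a bijection $f\colon V(G)\to\{1,2,\dots,n\}$, the weight of a vertex $u$ is $w_f(u)=\sum_{x\in N(u)}f(x)$, where $N(u)$ is the open neighborhood of $u$. The bijection $f$ is a local distance antimagic labeling of $G$ if $w_f(u)\neq w_f(v)$ for every edge $uv$ of $G$. The local distance antimagic chromatic number $\chi_{ld}(G)$ is the minimum number of distinct weights over all local distance antimagic labelings of $G$ (an upper bound on $\chi_{ld}$ includes the assertion that such a labeling exists). A neighborhood balanced coloring of a graph is an assignment of one of two colors to each vertex (not necessarily proper) such that every vertex has equally many neighbors of each color. The lexicographic product (composition) $G[H]$ has vertex set $V(G)\times V(H)$, with $(g,h)$ and $(g',h')$ adjacent iff either $gg'\in E(G)$, or $g=g'$ and $hh'\in E(H)$. -}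

module Defs where

open import Data.Bool using (Bool; true; false)
import Data.Bool as Bool
open import Data.Fin using (Fin; toℕ; finToFun; funToFin)
import Data.Fin as Fin
open import Data.Fin.Properties using (*↔×; all?; any?; finToFun-funToFin)
open import Data.List using (List; map; filter; length; sum; tabulate; deduplicate)
open import Data.List.Properties using (map-cong)
open import Data.Nat using (ℕ; suc; _*_; _^_; _≤_; _<_; _≟_; _<?_)
open import Data.Nat.Induction using (Acc; acc; <-wellFounded)
open import Data.Nat.Properties using (≮⇒≥)
open import Data.Product using (Σ; _×_; _,_; proj₁; proj₂; ∃)
open import Data.Product.Function.NonDependent.Propositional using (_×-↔_)
open import Data.Sum using (_⊎_; inj₁; inj₂)
open import Function using (_∘_; _↔_; _⤖_; Inverse; Bijection; mk⤖)
open import Function.Construct.Composition using (_↔-∘_; _⤖-∘_)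
open import Function.Construct.Symmetry using (↔-sym)
open import Function.Properties.Inverse using (↔⇒⤖; ↔⇒↣)
open import Relation.Binary using (Decidable; Symmetric; DecidableEquality)
open import Relation.Binary.PropositionalEquality
  using (_≡_; _≢_; _≗_; refl; sym; trans; cong; subst; subst₂)
open import Relation.Nullary using (¬_; Dec; yes; no)
open import Relation.Nullary.Decidable
  using (map′; ¬?; _×-dec_; _⊎-dec_; _→-dec_; via-injection)
import Relation.Unary as U

record Graph : Set₁ where
  infix 4 _~_ _~?_
  field
    V          : Set
    order      : ℕ
    enum       : V ↔ Fin order
    _~_        : V → V → Set
    _~?_       : Decidable _~_
    ~-sym      : Symmetric _~_
    ~-irrefl   : ∀ {u} → ¬ (u ~ u)
    noIsolated : ∀ u → ∃ λ v → u ~ v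

  _≟V_ : DecidableEquality V
  _≟V_ = via-injection (↔⇒↣ enum) Fin._≟_

  vertices : List V
  vertices = tabulate (Inverse.from enum)

  neighbors : V → List V
  neighbors u = filter (u ~?_) vertices

  degree : V → ℕ
  degree u = length (neighbors u)

  weight : (V → ℕ) → V → ℕ
  weight ℓ u = sum (map ℓ (neighbors u))

  numWeights : (V → ℕ) → ℕ
  numWeights ℓ = length (deduplicate _≟_ (map (weight ℓ) vertices))

  HasRegularity : ℕ → Set
  HasRegularity d = ∀ u → degree u ≡ d

  Regular : Set
  Regular = ∃ HasRegularity

  -- The two partite sets are the fibres of `side`.
  IsBipartition : (V → Bool) → Set
  IsBipartition side = ∀ {u v} → u ~ v → side u ≢ side v

  DegreeConstantOnParts : (V → Bool) → Set
  DegreeConstantOnParts side = ∀ u v → side u ≡ side v → degree u ≡ degree v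

  neighborsColored : (V → Bool) → Bool → V → List V
  neighborsColored c b u = filter (λ v → c v Bool.≟ b) (neighbors u)

  IsNeighborhoodBalanced : (V → Bool) → Set
  IsNeighborhoodBalanced c =
    ∀ u → length (neighborsColored c true u) ≡ length (neighborsColored c false u)

open Graph

_[_] : Graph → Graph → Graph
G [ H ] = record
  { V          = V G × V H
  ; order      = order G * order H
  ; enum       = ↔-sym *↔× ↔-∘ (enum G ×-↔ enum H)
  ; _~_        = λ (g , h) (g′ , h′) → G._~_ g g′ ⊎ (g ≡ g′ × H._~_ h h′)
  ; _~?_       = λ (g , h) (g′ , h′) →
                   G._~?_ g g′ ⊎-dec (G._≟V_ g g′ ×-dec H._~?_ h h′)
  ; ~-sym      = λ { (inj₁ e)       → inj₁ (G.~-sym e)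
                   ; (inj₂ (p , e)) → inj₂ (sym p , H.~-sym e) }
  ; ~-irrefl   = λ { (inj₁ e)       → G.~-irrefl e
                   ; (inj₂ (_ , e)) → H.~-irrefl e }
  ; noIsolated = λ (g , h) → let (g′ , e) = G.noIsolated g in (g′ , h) , inj₁ e
  }
  where
  module G = Graph G
  module H = Graph H

Labeling : Graph → Set
Labeling G = V G ⤖ Fin (order G)

-- The shift by one makes the labels 1, …, n rather than 0, …, n-1.
label : (G : Graph) → Labeling G → V G → ℕ
label G f v = suc (toℕ (Bijection.to f v))

IsLocalDistanceAntimagic : (G : Graph) → (V G → ℕ) → Set
IsLocalDistanceAntimagic G ℓ = ∀ u v → _~_ G u v → weight G ℓ u ≢ weight G ℓ v

LDALabeling : Graph → Set
LDALabeling G = Σ (Labeling G) λ f → IsLocalDistanceAntimagic G (label G f)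

weightCount : (G : Graph) → LDALabeling G → ℕ
weightCount G (f , _) = numWeights G (label G f)

IsMinWeightCount : Graph → ℕ → Set
IsMinWeightCount G k =
  (∃ λ (f : LDALabeling G) → weightCount G f ≡ k) ×
  (∀ (f : LDALabeling G) → k ≤ weightCount G f)

-- Minima need not exist constructively; here one does because the labelings
-- can be searched exhaustively, via Fin (n ^ n) and maps Fin n → Fin n.
private
  module Search (G : Graph) where
    n : ℕ
    n = order G

    to : V G → Fin n
    to = Inverse.to (enum G)

    from : Fin n → V G
    from = Inverse.from (enum G)

    allV? : {P : V G → Set} → U.Decidable P → Dec (∀ v → P v)
    allV? {P} P? = map′
      (λ p v → subst P (Inverse.strictlyInverseʳ (enum G) v) (p (to v)))
      (λ p i → p (from i))
      (all? (P? ∘ from))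

    weight-cong : {ℓ ℓ′ : V G → ℕ} → ℓ ≗ ℓ′ → weight G ℓ ≗ weight G ℓ′
    weight-cong eq u = cong sum (map-cong eq (neighbors G u))

    numWeights-cong : {ℓ ℓ′ : V G → ℕ} → ℓ ≗ ℓ′ → numWeights G ℓ ≡ numWeights G ℓ′
    numWeights-cong eq =
      cong (length ∘ deduplicate _≟_) (map-cong (weight-cong eq) (vertices G))

    LDA-cong : {ℓ ℓ′ : V G → ℕ} → ℓ ≗ ℓ′ →
               IsLocalDistanceAntimagic G ℓ → IsLocalDistanceAntimagic G ℓ′
    LDA-cong eq p u v e =
      subst₂ _≢_ (weight-cong eq u) (weight-cong eq v) (p u v e)

    LDA? : (ℓ : V G → ℕ) → Dec (IsLocalDistanceAntimagic G ℓ)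
    LDA? ℓ = allV? λ u → allV? λ v →
      _~?_ G u v →-dec ¬? (weight G ℓ u ≟ weight G ℓ v)

    Inj Surj : (Fin n → Fin n) → Set
    Inj  g = ∀ i j → g i ≡ g j → i ≡ j
    Surj g = ∀ j → ∃ λ i → g i ≡ j

    inj? : U.Decidable Inj
    inj? g = all? λ i → all? λ j → (g i Fin.≟ g j) →-dec (i Fin.≟ j)

    surj? : U.Decidable Surj
    surj? g = all? λ j → any? λ i → g i Fin.≟ j

    ℓ-of : (Fin n → Fin n) → V G → ℕ
    ℓ-of g v = suc (toℕ (g (to v)))

    Good : ℕ → (Fin n → Fin n) → Set
    Good k g = (Inj g × Surj g) ×
               (IsLocalDistanceAntimagic G (ℓ-of g) × numWeights G (ℓ-of g) < k)

    good? : ∀ k → U.Decidable (Good k)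
    good? k g = (inj? g ×-dec surj? g) ×-dec
                (LDA? (ℓ-of g) ×-dec (numWeights G (ℓ-of g) <? k))

    good-cong : ∀ {k g g′} → g ≗ g′ → Good k g → Good k g′
    good-cong {k} {g} {g′} eq ((i , s) , (a , b)) =
      ( (λ x y p → i x y (trans (eq x) (trans p (sym (eq y)))))
      , (λ y → let (x , p) = s y in x , trans (sym (eq x)) p) ) ,
      LDA-cong eqℓ a , subst (_< k) (numWeights-cong eqℓ) b
      where
      eqℓ : ℓ-of g ≗ ℓ-of g′
      eqℓ v = cong (suc ∘ toℕ) (eq (to v))

    Better : ℕ → Set
    Better k = ∃ λ (f : LDALabeling G) → weightCount G f < k

    good⇒better : ∀ {k g} → Good k g → Better k
    good⇒better {g = g} ((i , s) , (a , b)) = (g⤖ ⤖-∘ ↔⇒⤖ (enum G) , a) , b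
      where
      g⤖ : Fin n ⤖ Fin n
      g⤖ = mk⤖ ((λ {x} {y} → i x y)
               , λ y → let (x , p) = s y in x , λ {z} z≡x → trans (cong g z≡x) p)

    better⇒good : ∀ {k} → Better k → ∃ (Good k)
    better⇒good {k} ((f , a) , b) = Bijection.to h ,
      ( (λ x y → Bijection.injective h)
      , (λ y → let (x , p) = Bijection.surjective h y in x , p refl) ) ,
      LDA-cong eqℓ a , subst (_< k) (numWeights-cong eqℓ) b
      where
      h : Fin n ⤖ Fin n
      h = f ⤖-∘ ↔⇒⤖ (↔-sym (enum G))
      eqℓ : label G f ≗ ℓ-of (Bijection.to h)
      eqℓ v = cong (suc ∘ toℕ ∘ Bijection.to f)
                   (sym (Inverse.strictlyInverseʳ (enum G) v))

    better? : ∀ k → Dec (Better k)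
    better? k = map′
      (λ (c , p) → good⇒better p)
      (λ p → let (g , q) = better⇒good p in
             funToFin g , good-cong (λ i → sym (finToFun-funToFin g i)) q)
      (any? λ (c : Fin (n ^ n)) → good? k (finToFun c))

    search : (f : LDALabeling G) → Acc _<_ (weightCount G f) → ∃ (IsMinWeightCount G)
    search f (acc rec) with better? (weightCount G f)
    ... | yes (f′ , lt) = search f′ (rec lt)
    ... | no  none      =
      weightCount G f , (f , refl) , λ f′ → ≮⇒≥ λ lt → none (f′ , lt)

abstract
  minWeightCount : (G : Graph) → LDALabeling G → ∃ (IsMinWeightCount G)
  minWeightCount G f = Search.search G f (<-wellFounded _)

-- The second argument only witnesses that some labeling exists: the value is
-- the minimum over all of them, by χ-ld-isMin.
χ-ld : (G : Graph) → LDALabeling G → ℕ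
χ-ld G f = proj₁ (minWeightCount G f)

χ-ld-isMin : (G : Graph) (f : LDALabeling G) → IsMinWeightCount G (χ-ld G f)
χ-ld-isMin G f = proj₂ (minWeightCount G f)

{-# OPTIONS --safe #-}
-- Let m be the order of G, and let x be a zero-based labeling of H with weights
-- X h = Σ_{h′ ~ h} x h′. Blow every label of H up to a block of m labels:
-- number the vertices of G by 0, …, m-1 and give (g , h) the label
-- m · x h + (i + 1) or m · x h + (m - i), i being the number of g, according to
-- the colour of h in the balanced colouring. On every colour-balanced set of
-- vertices of H the offsets add up to something independent of i; both N(h) and,
-- by double counting, V(H) are balanced. Hence (g , h) has weight
-- deg g · S + m · X h + const, where S > m · Σ x ≥ m · X h. Along the edges
-- inside a copy of H the weights therefore differ as in H, along the other ones
-- they differ because the two degrees of G differ, and there are at most two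
-- weights for each weight of H.
module Submission where

open import Defs
open import Data.Bool using (Bool; true; false; if_then_else_)
import Data.Bool as Bool
open import Data.Bool.Properties using (¬-not)
open import Data.Fin using (Fin; toℕ; cast; combine; remQuot; opposite)
open import Data.Fin.Properties
  using (toℕ-cast; toℕ-combine; toℕ-injective; toℕ<n; cast-involutive;
         combine-injective; combine-remQuot; opposite-prop; opposite-involutive; any?; nonZeroIndex)
open import Data.List
  using (List; []; _∷_; _++_; map; filter; length; cartesianProduct; deduplicate)
open import Data.List.Properties
  using (map-cong; map-++; map-∘; length-map; length-++; filter-≐; filter-notAll)
open import Data.List.Membership.Propositional using (_∈_)
open import Data.List.Membership.Propositional.Properties
  using (∈-filter⁺; ∈-filter⁻; ∈-tabulate⁺; ∈-map⁺; ∈-map⁻; ∈-++⁺ˡ; ∈-++⁺ʳ; ∈-++⁻;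
         ∈-cartesianProduct⁺; ∈-cartesianProduct⁻; ∈-deduplicate⁺; ∈-deduplicate⁻; ∈-length)
open import Data.List.Membership.Propositional.Properties.WithK using (unique∧set⇒bag)
open import Data.List.Relation.Binary.BagAndSetEquality using (∼bag⇒↭)
open import Data.List.Relation.Binary.Permutation.Propositional using (_↭_)
open import Data.List.Relation.Binary.Permutation.Propositional.Properties using (map⁺)
open import Data.List.Relation.Binary.Subset.Propositional using (_⊆_)
import Data.List.Relation.Unary.All as All
import Data.List.Relation.Unary.Any as Any
open import Data.List.Relation.Unary.Any using (here; there)
open import Data.List.Relation.Unary.AllPairs using ([]; _∷_)
open import Data.List.Relation.Unary.Unique.Propositional using (Unique)
import Data.List.Relation.Unary.Unique.Propositional.Properties as Unique
open import Data.List.Relation.Unary.Unique.DecPropositional.Properties using (deduplicate-!)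
open import Data.Nat
  using (ℕ; suc; _+_; _*_; _∸_; _≤_; _<_; _≟_; z≤n; s≤s; NonZero; >-nonZero)
open import Data.Nat.ListAction using (sum)
open import Data.Nat.ListAction.Properties using (sum-++; sum-↭)
open import Data.Nat.Properties
open import Data.Nat.Solver using (module +-*-Solver)
open import Data.Product using (Σ; _×_; _,_; proj₁; proj₂; ∃; uncurry)
open import Data.Sum using (inj₁; inj₂)
open import Function using (_∘_; mk⇔; mk⤖; Inverse; Bijection; Injection)
open import Function.Consequences.Propositional using (strictlySurjective⇒surjective)
open import Function.Properties.Inverse using (↔-sym; ↔⇒↣)
open import Relation.Binary using (Decidable; tri<; tri≈; tri>)
open import Relation.Binary.PropositionalEquality
  using (_≡_; _≢_; refl; sym; trans; cong; cong₂; subst; module ≡-Reasoning)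
open import Relation.Nullary using (¬_; yes; no; does; contradiction)
open import Relation.Nullary.Decidable using (¬?)
import Relation.Unary as U

-- Counting and summation over lists.

-- Removing every `x` from `ys` still leaves room for the tail, which avoids `x`, and shortens `ys`
-- strictly because `x` occurs in it.
unique-⊆⇒length-≤ : {xs ys : List ℕ} → Unique xs → xs ⊆ ys → length xs ≤ length ys
unique-⊆⇒length-≤ [] _ = z≤n
unique-⊆⇒length-≤ {x ∷ xs} {ys} (x∉xs ∷ u) xs⊆ys = ≤-trans
  (s≤s (unique-⊆⇒length-≤ u λ y∈xs →
    ∈-filter⁺ (¬? ∘ (x ≟_)) (xs⊆ys (there y∈xs)) (All.lookup x∉xs y∈xs)))
  (filter-notAll (¬? ∘ (x ≟_)) ys (Any.map (λ x≡y x≢y → x≢y x≡y) (xs⊆ys (here refl))))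

module _ {A : Set} where

  sum-map-const : ∀ k (xs : List A) → sum (map (λ _ → k) xs) ≡ length xs * k
  sum-map-const k []       = refl
  sum-map-const k (x ∷ xs) = cong (k +_) (sum-map-const k xs)

  sum-map-affine : ∀ k (f g : A → ℕ) xs →
    sum (map (λ x → k * f x + g x) xs) ≡ k * sum (map f xs) + sum (map g xs)
  sum-map-affine k f g []       = solve 1 (λ k → con 0 := k :* con 0 :+ con 0) refl k
    where open +-*-Solver
  sum-map-affine k f g (x ∷ xs) = trans
    (cong (k * f x + g x +_) (sum-map-affine k f g xs))
    (solve 5 (λ k a b c d → k :* a :+ b :+ (k :* c :+ d) := k :* (a :+ c) :+ (b :+ d))
      refl k (f x) (g x) (sum (map f xs)) (sum (map g xs)))
    where open +-*-Solver

  sum-map-filter-≤ : {P : A → Set} (P? : U.Decidable P) (f : A → ℕ) (xs : List A) →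
    sum (map f (filter P? xs)) ≤ sum (map f xs)
  sum-map-filter-≤ P? f []       = z≤n
  sum-map-filter-≤ P? f (x ∷ xs) with does (P? x)
  ... | true  = +-monoʳ-≤ (f x) (sum-map-filter-≤ P? f xs)
  ... | false = m≤n⇒m≤o+n (f x) (sum-map-filter-≤ P? f xs)

  colored : (A → Bool) → Bool → List A → List A
  colored c b = filter (λ x → c x Bool.≟ b)

  Balanced : (A → Bool) → List A → Set
  Balanced c xs = length (colored c true xs) ≡ length (colored c false xs)

  sum-map-colored : ∀ (c : A → Bool) (φ : Bool → ℕ) xs →
    sum (map (φ ∘ c) xs) ≡
    length (colored c true xs) * φ true + length (colored c false xs) * φ false
  sum-map-colored c φ [] = refl
  sum-map-colored c φ (x ∷ xs) with c x
  ... | true  = trans (cong (φ true +_) (sum-map-colored c φ xs)) (sym (+-assoc (φ true) _ _))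
  ... | false = trans (cong (φ false +_) (sum-map-colored c φ xs))
    (solve 3 (λ p q r → p :+ (q :+ r) := q :+ (p :+ r)) refl
      (φ false) (length (colored c true xs) * φ true) (length (colored c false xs) * φ false))
    where open +-*-Solver

  -- Only `φ true + φ false` enters the result. With the two offsets of a vertex of `G` as `φ`, this
  -- makes the sum independent of that vertex.
  sum-map-balanced : ∀ (c : A → Bool) (φ : Bool → ℕ) xs → Balanced c xs →
    sum (map (φ ∘ c) xs) ≡ length (colored c true xs) * (φ true + φ false)
  sum-map-balanced c φ xs bal = begin
    sum (map (φ ∘ c) xs)                 ≡⟨ sum-map-colored c φ xs ⟩
    p * φ true + q * φ false             ≡⟨ cong (λ r → p * φ true + r * φ false) bal ⟨
    p * φ true + p * φ false             ≡⟨ *-distribˡ-+ p _ _ ⟨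
    p * (φ true + φ false)               ∎
    where
    open ≡-Reasoning
    p = length (colored c true xs)
    q = length (colored c false xs)

module _ {A B : Set} where

  sum-map-cartesianProduct : ∀ (f : A × B → ℕ) xs ys →
    sum (map f (cartesianProduct xs ys)) ≡
    sum (map (λ x → sum (map (λ y → f (x , y)) ys)) xs)
  sum-map-cartesianProduct f []       ys = refl
  sum-map-cartesianProduct f (x ∷ xs) ys = begin
    sum (map f (map (x ,_) ys ++ cartesianProduct xs ys))
      ≡⟨ cong sum (map-++ f (map (x ,_) ys) _) ⟩
    sum (map f (map (x ,_) ys) ++ map f (cartesianProduct xs ys))
      ≡⟨ sum-++ (map f (map (x ,_) ys)) _ ⟩
    sum (map f (map (x ,_) ys)) + sum (map f (cartesianProduct xs ys))
      ≡⟨ cong₂ _+_ (cong sum (sym (map-∘ ys))) (sum-map-cartesianProduct f xs ys) ⟩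
    sum (map (λ x → sum (map (λ y → f (x , y)) ys)) (x ∷ xs)) ∎
    where open ≡-Reasoning

  -- Both sides sum `f y` over the related pairs, by rows and by columns. Induction on the rows;
  -- `step` adds one row by running through the columns.
  double-counting : {R : A → B → Set} (R? : Decidable R) (f : B → ℕ) (xs : List A) (ys : List B) →
    sum (map (λ x → sum (map f (filter (R? x) ys))) xs) ≡
    sum (map (λ y → length (filter (λ x → R? x y) xs) * f y) ys)
  double-counting R? f [] ys = sym (trans (sum-map-const 0 ys) (*-zeroʳ (length ys)))
  double-counting R? f (x ∷ xs) ys =
    trans (cong (sum (map f (filter (R? x) ys)) +_) (double-counting R? f xs ys)) (step ys)
    where
    open +-*-Solver
    step : ∀ ys →
      sum (map f (filter (R? x) ys)) +
      sum (map (λ y → length (filter (λ x′ → R? x′ y) xs) * f y) ys) ≡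
      sum (map (λ y → length (filter (λ x′ → R? x′ y) (x ∷ xs)) * f y) ys)
    step []       = refl
    step (y ∷ ys) with does (R? x y)
    ... | true  = trans
      (solve 4 (λ a b c d → a :+ b :+ (c :+ d) := a :+ c :+ (b :+ d)) refl (f y) _ _ _)
      (cong (f y + length (filter (λ x′ → R? x′ y) xs) * f y +_) (step ys))
    ... | false = trans
      (solve 3 (λ b c d → b :+ (c :+ d) := c :+ (b :+ d)) refl
        (sum (map f (filter (R? x) ys))) (length (filter (λ x′ → R? x′ y) xs) * f y) _)
      (cong (length (filter (λ x′ → R? x′ y) xs) * f y +_) (step ys))

-- Neighborhoods and balanced colorings of a single graph.

module GraphProperties (G : Graph) where
  open Graph G

  vertex∈ : ∀ v → v ∈ vertices
  vertex∈ v = subst (_∈ vertices) (Inverse.strictlyInverseʳ enum v)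
    (∈-tabulate⁺ (Inverse.to enum v))

  vertices-! : Unique vertices
  vertices-! = Unique.tabulate⁺ (Injection.injective (↔⇒↣ (↔-sym enum)))

  neighbors-! : ∀ u → Unique (neighbors u)
  neighbors-! u = Unique.filter⁺ (u ~?_) vertices-!

  ∈-neighbors⁺ : ∀ {u v} → u ~ v → v ∈ neighbors u
  ∈-neighbors⁺ {u} {v} = ∈-filter⁺ (u ~?_) (vertex∈ v)

  ∈-neighbors⁻ : ∀ {u v} → v ∈ neighbors u → u ~ v
  ∈-neighbors⁻ {u} = proj₂ ∘ ∈-filter⁻ (u ~?_) {xs = vertices}

  degree>0 : ∀ u → 0 < degree u
  degree>0 u = ∈-length (∈-neighbors⁺ (proj₂ (noIsolated u)))

  -- Each `v` is counted once for every `u` adjacent to it; symmetry of adjacency identifies the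
  -- number of these `u` with the degree of `v`.
  sum-neighbor-sums : ∀ f → sum (map (weight f) vertices) ≡ sum (map (λ v → degree v * f v) vertices)
  sum-neighbor-sums f = trans (double-counting _~?_ f vertices vertices)
    (cong sum (map-cong (λ v → cong (λ l → length l * f v)
      (filter-≐ (_~? v) (v ~?_) (~-sym , ~-sym) vertices)) vertices))

  module _ {c : V → Bool} (bal : IsNeighborhoodBalanced c) where

    -- Counting pairs of a vertex and a neighbor of color `b` gives `d` times the size of class `b`.
    -- Balance at each vertex makes the two counts equal, and `d` cancels: it is positive because
    -- `v` is not isolated.
    colorClasses-balanced : ∀ {d} → HasRegularity d → V → Balanced c vertices
    colorClasses-balanced {d} reg v =
      *-cancelˡ-≡ _ _ d (trans (sym (count true)) (trans balanced-count (count false)))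
      where
      open ≡-Reasoning
      instance
        d≢0 : NonZero d
        d≢0 = >-nonZero (subst (0 <_) (reg v) (degree>0 v))
      [_] : Bool → Bool → ℕ
      -- As an indicator of the color `b`, this turns the number of `b`-colored neighbors into a
      -- weight, to which `sum-neighbor-sums` applies.
      [ b ] b′ = if does (b′ Bool.≟ b) then 1 else 0
      sum-indicator : ∀ b xs → sum (map ([ b ] ∘ c) xs) ≡ length (colored c b xs)
      sum-indicator true  xs = trans (sum-map-colored c [ true ] xs)
        (trans (cong₂ _+_ (*-identityʳ _) (*-zeroʳ (length (colored c false xs)))) (+-identityʳ _))
      sum-indicator false xs = trans (sum-map-colored c [ false ] xs)
        (cong₂ _+_ (*-zeroʳ (length (colored c true xs))) (*-identityʳ _))
      count : ∀ b → sum (map (λ u → length (neighborsColored c b u)) vertices) ≡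
                    d * length (colored c b vertices)
      count b = begin
        sum (map (λ u → length (neighborsColored c b u)) vertices)
          ≡⟨ cong sum (map-cong (λ u → sym (sum-indicator b (neighbors u))) vertices) ⟩
        sum (map (weight ([ b ] ∘ c)) vertices)
          ≡⟨ sum-neighbor-sums ([ b ] ∘ c) ⟩
        sum (map (λ v → degree v * [ b ] (c v)) vertices)
          -- The summand `+ 0` is inserted only to match the shape of `sum-map-affine`.
          ≡⟨ cong sum (map-cong (λ v → trans (cong (_* [ b ] (c v)) (reg v)) (sym (+-identityʳ _))) vertices) ⟩
        sum (map (λ v → d * [ b ] (c v) + 0) vertices)
          ≡⟨ sum-map-affine d ([ b ] ∘ c) (λ _ → 0) vertices ⟩
        d * sum (map ([ b ] ∘ c) vertices) + sum (map (λ _ → 0) vertices)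
          ≡⟨ cong₂ _+_ (cong (d *_) (sum-indicator b vertices))
               (trans (sum-map-const 0 vertices) (*-zeroʳ (length vertices))) ⟩
        d * length (colored c b vertices) + 0
          ≡⟨ +-identityʳ _ ⟩
        d * length (colored c b vertices) ∎
      balanced-count : sum (map (λ u → length (neighborsColored c true u)) vertices) ≡
                       sum (map (λ u → length (neighborsColored c false u)) vertices)
      balanced-count = cong sum (map-cong bal vertices)

    coloredDegree : ∀ {t} → HasRegularity (2 * t) → ∀ u → length (neighborsColored c true u) ≡ t
    coloredDegree {t} reg u = *-cancelˡ-≡ _ _ 2 (begin
      2 * k                            ≡⟨ *-comm 2 k ⟩
      k * 2                            ≡⟨ sum-map-balanced c (λ _ → 1) (neighbors u) (bal u) ⟨
      sum (map (λ _ → 1) (neighbors u)) ≡⟨ sum-map-const 1 (neighbors u) ⟩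
      degree u * 1                     ≡⟨ *-identityʳ _ ⟩
      degree u                         ≡⟨ reg u ⟩
      2 * t                            ∎)
      where
      open ≡-Reasoning
      k = length (neighborsColored c true u)

-- Neighborhoods and weights in the lexicographic product.

module _ (G H : Graph) where
  private
    module G where
      open Graph G public
      open GraphProperties G public
    module H where
      open Graph H public
      open GraphProperties H public
    module GH where
      open Graph (G [ H ]) public
      open GraphProperties (G [ H ]) public

  -- Two duplicate-free lists with the same members are permutations of each other. The appended
  -- list is duplicate-free because a common member of its halves would make `g` adjacent to itself.
  neighbors-[] : ∀ g h →
    GH.neighbors (g , h) ↭ cartesianProduct (G.neighbors g) H.vertices ++ map (g ,_) (H.neighbors h)
  neighbors-[] g h = ∼bag⇒↭ (unique∧set⇒bag
    (GH.neighbors-! (g , h))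
    (Unique.++⁺ (Unique.cartesianProduct⁺ (G.neighbors-! g) H.vertices-!)
      (Unique.map⁺ (λ { refl → refl }) (H.neighbors-! h))
      disjoint)
    (mk⇔ (join ∘ GH.∈-neighbors⁻) split))
    where
    disjoint : ∀ {v} → ¬ (v ∈ cartesianProduct (G.neighbors g) H.vertices × v ∈ map (g ,_) (H.neighbors h))
    disjoint (p , q) with (_ , _ , refl) ← ∈-map⁻ (g ,_) q =
      G.~-irrefl (G.∈-neighbors⁻ (proj₁ (∈-cartesianProduct⁻ (G.neighbors g) H.vertices p)))
    join : ∀ {v} → (g , h) GH.~ v →
      v ∈ cartesianProduct (G.neighbors g) H.vertices ++ map (g ,_) (H.neighbors h)
    join {_ , h′} (inj₁ e) = ∈-++⁺ˡ (∈-cartesianProduct⁺ (G.∈-neighbors⁺ e) (H.vertex∈ h′))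
    join (inj₂ (refl , e)) =
      ∈-++⁺ʳ (cartesianProduct (G.neighbors g) H.vertices) (∈-map⁺ (g ,_) (H.∈-neighbors⁺ e))
    split : ∀ {v} → v ∈ cartesianProduct (G.neighbors g) H.vertices ++ map (g ,_) (H.neighbors h) →
      v ∈ GH.neighbors (g , h)
    split v∈ with ∈-++⁻ (cartesianProduct (G.neighbors g) H.vertices) v∈
    ... | inj₁ p = GH.∈-neighbors⁺
      (inj₁ (G.∈-neighbors⁻ (proj₁ (∈-cartesianProduct⁻ (G.neighbors g) H.vertices p))))
    ... | inj₂ q with (_ , h′∈ , refl) ← ∈-map⁻ (g ,_) q =
      GH.∈-neighbors⁺ (inj₂ (refl , H.∈-neighbors⁻ h′∈))

  weight-[] : ∀ ℓ g h → GH.weight ℓ (g , h) ≡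
    G.weight (λ g′ → sum (map (λ h′ → ℓ (g′ , h′)) H.vertices)) g + H.weight (λ h′ → ℓ (g , h′)) h
  weight-[] ℓ g h = begin
    GH.weight ℓ (g , h)
      ≡⟨ sum-↭ (map⁺ ℓ (neighbors-[] g h)) ⟩
    sum (map ℓ (cartesianProduct (G.neighbors g) H.vertices ++ map (g ,_) (H.neighbors h)))
      ≡⟨ cong sum (map-++ ℓ (cartesianProduct (G.neighbors g) H.vertices) _) ⟩
    sum (map ℓ (cartesianProduct (G.neighbors g) H.vertices) ++ map ℓ (map (g ,_) (H.neighbors h)))
      ≡⟨ sum-++ (map ℓ (cartesianProduct (G.neighbors g) H.vertices)) _ ⟩
    sum (map ℓ (cartesianProduct (G.neighbors g) H.vertices)) + sum (map ℓ (map (g ,_) (H.neighbors h)))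
      ≡⟨ cong₂ _+_ (sum-map-cartesianProduct ℓ (G.neighbors g) H.vertices)
           (cong sum (sym (map-∘ (H.neighbors h)))) ⟩
    G.weight (λ g′ → sum (map (λ h′ → ℓ (g′ , h′)) H.vertices)) g + H.weight (λ h′ → ℓ (g , h′)) h ∎
    where open ≡-Reasoning

  -- The blown-up labeling and its bijectivity.

  module BlowUp (c : H.V → Bool) (f : Labeling H) where
    private
      m n : ℕ
      m = G.order
      n = H.order

      x : H.V → ℕ
      x = toℕ ∘ Bijection.to f

    reflectIf : Bool → Fin m → Fin m
    reflectIf true  i = i
    reflectIf false i = opposite i

    reflectIf-involutive : ∀ b i → reflectIf b (reflectIf b i) ≡ i
    reflectIf-involutive true  i = refl
    reflectIf-involutive false i = opposite-involutive i

    reflectIf-injective : ∀ b {i j} → reflectIf b i ≡ reflectIf b j → i ≡ j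
    reflectIf-injective b {i} {j} eq = trans (sym (reflectIf-involutive b i))
      (trans (cong (reflectIf b) eq) (reflectIf-involutive b j))

    -- In one-based form the offsets are `i + 1` and `m - i`, so `i` cancels.
    reflectIf-sum : ∀ i → suc (toℕ (reflectIf true i)) + suc (toℕ (reflectIf false i)) ≡ suc m
    reflectIf-sum i = begin
      suc (toℕ i) + suc (toℕ (opposite i)) ≡⟨ +-suc (suc (toℕ i)) (toℕ (opposite i)) ⟩
      suc (suc (toℕ i) + toℕ (opposite i)) ≡⟨ cong (λ k → suc (suc (toℕ i) + k)) (opposite-prop i) ⟩
      suc (suc (toℕ i) + (m ∸ suc (toℕ i))) ≡⟨ cong suc (m+[n∸m]≡n (toℕ<n i)) ⟩
      suc m                                 ∎
      where open ≡-Reasoning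

    offset : G.V → H.V → Fin m
    offset g h = reflectIf (c h) (Inverse.to G.enum g)

    -- `combine` yields the value `m * x h` plus the offset, but in `Fin (n * m)`; the cast only
    -- swaps the factors to match the order of `G [ H ]`.
    to : GH.V → Fin (m * n)
    to (g , h) = cast (*-comm n m) (combine (Bijection.to f h) (offset g h))

    to-injective : ∀ {u v} → to u ≡ to v → u ≡ v
    to-injective {g , h} {g′ , h′} eq
      with eqH , eqG ← combine-injective _ _ _ _
             (toℕ-injective (trans (sym (toℕ-cast (*-comm n m) _))
               (trans (cong toℕ eq) (toℕ-cast (*-comm n m) _))))
      with refl ← Bijection.injective f eqH =
      cong (_, h) (Injection.injective (↔⇒↣ G.enum) (reflectIf-injective (c h) eqG))

    to-surjective : ∀ k → ∃ λ v → to v ≡ k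
    to-surjective k = (g , h) , (begin
      to (g , h)
        ≡⟨ cong (cast (*-comm n m)) (cong₂ combine (proj₂ (Bijection.surjective f (proj₁ ij)) refl)
             (trans (cong (reflectIf (c h)) (Inverse.strictlyInverseˡ G.enum _))
               (reflectIf-involutive (c h) (proj₂ ij)))) ⟩
      cast (*-comm n m) (uncurry combine ij)
        ≡⟨ cong (cast (*-comm n m)) (combine-remQuot {n} m (cast (*-comm m n) k)) ⟩
      cast (*-comm n m) (cast (*-comm m n) k)
        ≡⟨ cast-involutive (*-comm n m) (*-comm m n) k ⟩
      k ∎)
      where
      open ≡-Reasoning
      ij = remQuot {n} m (cast (*-comm m n) k)
      h  = proj₁ (Bijection.surjective f (proj₁ ij))
      -- The remainder is reflected in advance, so that the reflection inside `offset` undoes it.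
      g  = Inverse.from G.enum (reflectIf (c h) (proj₂ ij))

    labeling : Labeling (G [ H ])
    labeling = mk⤖ (to-injective , strictlySurjective⇒surjective to-surjective)

    ℓ : GH.V → ℕ
    ℓ = label (G [ H ]) labeling

    ℓ-affine : ∀ g h → ℓ (g , h) ≡ m * x h + suc (toℕ (offset g h))
    ℓ-affine g h = begin
      suc (toℕ (to (g , h)))                 ≡⟨ cong suc (toℕ-cast (*-comm n m) _) ⟩
      suc (toℕ (combine (Bijection.to f h) (offset g h)))
                                             ≡⟨ cong suc (toℕ-combine (Bijection.to f h) (offset g h)) ⟩
      suc (m * x h + toℕ (offset g h))       ≡⟨ +-suc _ _ ⟨
      m * x h + suc (toℕ (offset g h))       ∎
      where open ≡-Reasoning

    -- The offsets contribute `suc m` per pair of opposite colors, so `g` disappears. Applied below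
    -- both to a whole copy of `H` and to a neighborhood in `H`.
    ℓ-sum-balanced : ∀ g L → Balanced c L →
      sum (map (λ h → ℓ (g , h)) L) ≡ m * sum (map x L) + length (colored c true L) * suc m
    ℓ-sum-balanced g L bal = begin
      sum (map (λ h → ℓ (g , h)) L)
        ≡⟨ cong sum (map-cong (ℓ-affine g) L) ⟩
      sum (map (λ h → m * x h + suc (toℕ (offset g h))) L)
        ≡⟨ sum-map-affine m x _ L ⟩
      m * sum (map x L) + sum (map (λ h → suc (toℕ (offset g h))) L)
        ≡⟨ cong (m * sum (map x L) +_)
             (sum-map-balanced c (λ b → suc (toℕ (reflectIf b (Inverse.to G.enum g)))) L bal) ⟩
      m * sum (map x L) + length (colored c true L) * (suc (toℕ (reflectIf true i)) + suc (toℕ (reflectIf false i)))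
        ≡⟨ cong (λ s → m * sum (map x L) + length (colored c true L) * s) (reflectIf-sum i) ⟩
      m * sum (map x L) + length (colored c true L) * suc m ∎
      where
      open ≡-Reasoning
      i = Inverse.to G.enum g

    -- Weights of the blown-up labeling: antimagic property and count.

    module _ (nonRegular : ¬ G.Regular) (side : G.V → Bool) (bip : G.IsBipartition side)
             (degConst : G.DegreeConstantOnParts side)
             (t : ℕ) (reg : H.HasRegularity (2 * t)) (bal : H.IsNeighborhoodBalanced c)
             (antimagic : IsLocalDistanceAntimagic H (label H f)) where

      -- The label sum of a copy of `H`, the same for every vertex of `G`.
      copySum : ℕ
      copySum = m * sum (map x H.vertices) + length (colored c true H.vertices) * suc m

      -- Each of the `G.degree g` adjacent copies contributes `copySum`; in its own copy `h` sees
      -- `t` vertices of each color.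
      weight-blowUp : ∀ g h →
        GH.weight ℓ (g , h) ≡ G.degree g * copySum + (m * H.weight x h + t * suc m)
      weight-blowUp g h = begin
        GH.weight ℓ (g , h)
          ≡⟨ weight-[] ℓ g h ⟩
        G.weight (λ g′ → sum (map (λ h′ → ℓ (g′ , h′)) H.vertices)) g + H.weight (λ h′ → ℓ (g , h′)) h
          ≡⟨ cong₂ _+_
               (trans (cong sum (map-cong
                   (λ g′ → ℓ-sum-balanced g′ H.vertices (H.colorClasses-balanced bal reg h))
                   (G.neighbors g)))
                 (sum-map-const copySum (G.neighbors g)))
               (trans (ℓ-sum-balanced g (H.neighbors h) (bal h))
                 (cong (λ k → m * H.weight x h + k * suc m) (H.coloredDegree bal {t} reg h))) ⟩
        G.degree g * copySum + (m * H.weight x h + t * suc m) ∎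
        where open ≡-Reasoning

      -- The labels of `H` start at 1 and `x` at 0; with `2 * t` neighbors everywhere the shift is
      -- constant, so distinctness of weights carries over to `x`.
      weight-label : ∀ h → H.weight (label H f) h ≡ 2 * t + H.weight x h
      weight-label h = begin
        H.weight (label H f) h
          ≡⟨ cong sum (map-cong (λ v → trans (cong suc (sym (*-identityˡ (x v)))) (+-comm 1 _)) (H.neighbors h)) ⟩
        sum (map (λ v → 1 * x v + 1) (H.neighbors h))
          ≡⟨ sum-map-affine 1 x (λ _ → 1) (H.neighbors h) ⟩
        1 * H.weight x h + sum (map (λ _ → 1) (H.neighbors h))
          ≡⟨ cong₂ _+_ (*-identityˡ _) (trans (sum-map-const 1 (H.neighbors h)) (*-identityʳ _)) ⟩
        H.weight x h + H.degree h
          ≡⟨ trans (cong (H.weight x h +_) (reg h)) (+-comm _ (2 * t)) ⟩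
        2 * t + H.weight x h ∎
        where open ≡-Reasoning

      colorClass-nonEmpty : H.V → 0 < length (colored c true H.vertices)
      colorClass-nonEmpty h with c h in eq
      ... | true  = ∈-length (∈-filter⁺ (λ v → c v Bool.≟ true) (H.vertex∈ h) eq)
      ... | false = subst (0 <_) (sym (H.colorClasses-balanced bal reg h))
        (∈-length (∈-filter⁺ (λ v → c v Bool.≟ false) (H.vertex∈ h) eq))

      -- A neighborhood sum is at most the full sum; strictness comes from the offset term of
      -- `copySum`, positive because the color class is nonempty.
      innerWeight<copySum : ∀ h → m * H.weight x h < copySum
      innerWeight<copySum h = begin-strict
        m * H.weight x h             ≤⟨ *-monoʳ-≤ m (sum-map-filter-≤ (h H.~?_) x H.vertices) ⟩
        m * sum (map x H.vertices)   <⟨ m<m+n _ (*-mono-< (colorClass-nonEmpty h) (s≤s (z≤n {m}))) ⟩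
        copySum                      ∎
        where open ≤-Reasoning

      -- The degree acts as the leading digit in base `copySum`: one unit of it outweighs any
      -- `m * H.weight x h`, and the last term is common to all vertices.
      degree-<⇒weight-< : ∀ {g g′} h h′ → G.degree g < G.degree g′ →
        GH.weight ℓ (g , h) < GH.weight ℓ (g′ , h′)
      degree-<⇒weight-< {g} {g′} h h′ lt = begin-strict
        GH.weight ℓ (g , h)
          ≡⟨ trans (weight-blowUp g h) (sym (+-assoc (G.degree g * copySum) _ _)) ⟩
        G.degree g * copySum + m * H.weight x h + t * suc m
          <⟨ +-monoˡ-< (t * suc m) (+-monoʳ-< (G.degree g * copySum) (innerWeight<copySum h)) ⟩
        G.degree g * copySum + copySum + t * suc m
          ≡⟨ cong (_+ t * suc m) (+-comm _ copySum) ⟩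
        suc (G.degree g) * copySum + t * suc m
          ≤⟨ +-mono-≤ (*-monoˡ-≤ copySum lt) (m≤n+m (t * suc m) (m * H.weight x h′)) ⟩
        G.degree g′ * copySum + (m * H.weight x h′ + t * suc m)
          ≡⟨ weight-blowUp g′ h′ ⟨
        GH.weight ℓ (g′ , h′) ∎
        where open ≤-Reasoning

      -- An edge meets both parts, so equal degrees at its ends would give both parts the same
      -- degree and make `G` regular.
      degree-edge-≢ : ∀ {g g′} → g G.~ g′ → G.degree g ≢ G.degree g′
      degree-edge-≢ {g} {g′} e deg≡ = nonRegular (G.degree g , constant)
        where
        constant : G.HasRegularity (G.degree g)
        constant u with side u Bool.≟ side g
        ... | yes same = degConst u g same
        -- With only two sides, a vertex not on the side of `g` is on the side of `g′`.
        ... | no other = trans (degConst u g′ (trans (¬-not other) (sym (¬-not (bip e ∘ sym))))) (sym deg≡)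

      ℓ-antimagic : IsLocalDistanceAntimagic (G [ H ]) ℓ
      ℓ-antimagic (g , h) (g′ , h′) (inj₁ e) eq with <-cmp (G.degree g) (G.degree g′)
      ... | tri< lt _ _ = <⇒≢ (degree-<⇒weight-< h h′ lt) eq
      ... | tri≈ _ same _ = degree-edge-≢ e same
      ... | tri> _ _ gt = <⇒≢ (degree-<⇒weight-< h′ h gt) (sym eq)
      ℓ-antimagic (g , h) (.g , h′) (inj₂ (refl , e)) eq =
        antimagic h h′ e (trans (weight-label h) (trans (cong (2 * t +_) X≡) (sym (weight-label h′))))
        where
        instance
          m≢0 : NonZero m
          -- The index of `g` inhabits `Fin m`, so the factor `m` may be cancelled.
          m≢0 = nonZeroIndex (Inverse.to G.enum g)
        X≡ : H.weight x h ≡ H.weight x h′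
        X≡ = *-cancelˡ-≡ _ _ m (+-cancelʳ-≡ (t * suc m) _ _ (+-cancelˡ-≡ (G.degree g * copySum) _ _
          (trans (sym (weight-blowUp g h)) (trans eq (weight-blowUp g h′)))))

      -- The value 0 is irrelevant: it is taken only on an empty part.
      partDegree : Bool → ℕ
      partDegree b with any? (λ i → side (Inverse.from G.enum i) Bool.≟ b)
      ... | yes (i , _) = G.degree (Inverse.from G.enum i)
      ... | no _        = 0

      degree≡partDegree : ∀ g → G.degree g ≡ partDegree (side g)
      degree≡partDegree g with any? (λ i → side (Inverse.from G.enum i) Bool.≟ side g)
      ... | yes (i , eq) = degConst g _ (sym eq)
      ... | no none      =
        contradiction (Inverse.to G.enum g , cong side (Inverse.strictlyInverseʳ G.enum g)) none

      -- Here `w` is a weight for the one-based labels of `H`; subtracting `2 * t` recovers the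
      -- zero-based one. Thus a weight of the product is determined by a side of `G` and a weight of
      -- `H`.
      blowUpWeight : Bool → ℕ → ℕ
      blowUpWeight b w = partDegree b * copySum + (m * (w ∸ 2 * t) + t * suc m)

      weight≡blowUpWeight : ∀ g h →
        GH.weight ℓ (g , h) ≡ blowUpWeight (side g) (H.weight (label H f) h)
      weight≡blowUpWeight g h = trans (weight-blowUp g h)
        (cong₂ (λ d w → d * copySum + (m * w + t * suc m)) (degree≡partDegree g)
          (sym (trans (cong (_∸ 2 * t) (weight-label h)) (m+n∸m≡n (2 * t) _))))

      numWeights-≤ : GH.numWeights ℓ ≤ 2 * H.numWeights (label H f)
      numWeights-≤ = begin
        GH.numWeights ℓ
          ≤⟨ unique-⊆⇒length-≤ (deduplicate-! _≟_ weights) weights⊆ ⟩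
        length (map (blowUpWeight true) W ++ map (blowUpWeight false) W)
          ≡⟨ length-++ (map (blowUpWeight true) W) ⟩
        length (map (blowUpWeight true) W) + length (map (blowUpWeight false) W)
          ≡⟨ cong₂ _+_ (length-map _ W) (trans (length-map _ W) (sym (+-identityʳ _))) ⟩
        2 * length W ∎
        where
        open ≤-Reasoning
        W weights : List ℕ
        W = deduplicate _≟_ (map (H.weight (label H f)) H.vertices)
        weights = map (GH.weight ℓ) GH.vertices
        choose : ∀ b {w} → w ∈ map (blowUpWeight b) W →
          w ∈ map (blowUpWeight true) W ++ map (blowUpWeight false) W
        choose true  = ∈-++⁺ˡ
        choose false = ∈-++⁺ʳ (map (blowUpWeight true) W)
        weights⊆ : deduplicate _≟_ weights ⊆ map (blowUpWeight true) W ++ map (blowUpWeight false) W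
        weights⊆ w∈ with ((g , h) , _ , refl) ← ∈-map⁻ (GH.weight ℓ) (∈-deduplicate⁻ _≟_ weights w∈) =
          choose (side g) (subst (_∈ map (blowUpWeight (side g)) W) (sym (weight≡blowUpWeight g h))
            (∈-map⁺ (blowUpWeight (side g)) (∈-deduplicate⁺ _≟_ (∈-map⁺ (H.weight (label H f)) (H.vertex∈ h)))))

theorem6p4 : (G H : Graph) (t : ℕ) →
    ¬ Graph.Regular G →
    (∃ λ (side : Graph.V G → Bool) →
    Graph.IsBipartition G side × Graph.DegreeConstantOnParts G side) →
    Graph.HasRegularity H (2 * t) →
    (∃ λ (c : Graph.V H → Bool) → Graph.IsNeighborhoodBalanced H c) →
    (fH : LDALabeling H) →
    Σ (LDALabeling (G [ H ])) λ fGH → χ-ld (G [ H ]) fGH ≤ 2 * χ-ld H fH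
theorem6p4 G H t nonRegular (side , bip , degConst) reg (c , bal) fH
  -- The given `fH` may have too many weights, so the labeling blown up is one that attains the
  -- minimum for `H`.
  with (f , antimagic) , count≡ ← proj₁ (χ-ld-isMin H fH) = fGH , (begin
    χ-ld (G [ H ]) fGH           ≤⟨ proj₂ (χ-ld-isMin (G [ H ]) fGH) fGH ⟩
    weightCount (G [ H ]) fGH    ≤⟨ numWeights-≤ f nonRegular side bip degConst t reg bal antimagic ⟩
    2 * Graph.numWeights H (label H f) ≡⟨ cong (2 *_) count≡ ⟩
    2 * χ-ld H fH                ∎)
  where
  open ≤-Reasoning
  open BlowUp G H c
  fGH = labeling f , ℓ-antimagic f nonRegular side bip degConst t reg bal antimagic
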